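{- For every coherent configuration $(X,S)$, the associated Frobenius structure $(S,\nabla,e,\Delta,e^\dagger)$ in $\mathbf{Mat}_{\mathbb R_0^+}$ is (a) special if and only if $(X,S)$ is thin; (b) symmetric if and only if $(X,S)$ is $\frac12$-homogeneous; (c) extra if and only if $(X,S)$ is an association scheme.
   Context: $\mathbf{Mat}_{\mathbb R_0^+}$ is the category whose objects are finite sets and whose morphisms $f\colon X\to Y$ are matrices $(f_x^y)_{x\in X,y\in Y}$ of non-negative reals, with composition $(g\circ f)_a^c=\sum_{b}f_a^b g_b^c$. It is symmetric monoidal with $X\otimes Y=X\times Y$, $(f\otimes g)_{ac}^{bd}=f_a^b g_c^d$, unit object $I=\{*\}$, symmetry $\sigma$; $f^\dagger$ is the transpose of $f$. A coherent configuration $(X,S)$ is a finite set $X$ with a partition $S$ of $X\times X$ such that: if $p\in S$ contains some $(x,x)$ then $p\subseteq\mathrm{id}_X$; for $a,b,c\in S$ the number $\nabla_{ab}^c$ of $z\in X$ with $(x,z)\in a$, $(z,y)\in b$ is the same for all $(x,y)\in c$; and $c\in S$ implies $c^{ -1}=\{(y,x):(x,y)\in c\}\in S$. Elements of $S$ are colors; $E_S=\{p\in S:p\subseteq \mathrm{id}_X\}$ is the set of unit colors. For $a\in S$ the source $s(a)$ is the unique $q\in E_S$ with $\nabla_{aa^{ -1}}^q>0$, and the valency is $\|a\|=\nabla_{aa^{ -1}}^{s(a)}$ (the number of $y$ with $(x,y)\in a$, for any $x$ for which such a $y$ exists). $(X,S)$ is thin if $\|a\|=1$ for all $a\in S$;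 $\frac12$-homogeneous if all unit colors have the same cardinality as subsets of $X\times X$; an association scheme if $\mathrm{id}_X\in S$. The Frobenius structure associated with $(X,S)$ consists of the monoid $(S,\nabla,e)$, where $\nabla\colon S\otimes S\to S$ is the matrix of the $\nabla_{ab}^c$ and $e\colon I\to S$ has $e_*^a=1$ if $a\in E_S$, $0$ otherwise, together with the comonoid $(S,\Delta,e^\dagger)$ with $\Delta_a^{bc}=\frac{1}{\|b^{ -1}\|}\nabla_{b^{ -1}a}^c$ (which equals $\frac{1}{\|c\|}\nabla_{ac^{ -1}}^b$). A Frobenius structure with multiplication $\nabla$, unit $e$, comultiplication $\Delta$, counit $c$ on $S$ is special if $\nabla\circ\Delta=t\cdot\mathrm{id}_S$ for some scalar $t\in\mathbb R_0^+$; symmetric if $c\circ\nabla\circ\sigma_{S,S}=c\circ\nabla$; extra if $c\circ e=\mathrm{id}_I$. -}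

module Defs where

open import Data.Fin.Base using (Fin)
open import Data.Fin.Properties using (inj⇒≟; *↔×; 1↔⊤)
open import Data.Integer.Base using (+_)
open import Data.List.Base using (List; _∷_; length; filter; tabulate)
open import Data.List.Membership.Propositional using (_∈_)
open import Data.List.Membership.Propositional.Properties
  using (∈-tabulate⁺; ∈-filter⁺; ∈-filter⁻; ∈-length)
open import Data.List.Relation.Unary.Any using (here)
open import Data.Nat.Base as ℕ using (ℕ)
import Data.Nat.Properties as ℕ
open import Data.Product using (∃!)
open import Data.Product.Base using (∃; ∃-syntax; ∃₂; _×_; _,_; proj₁; proj₂; swap)
open import Data.Product.Function.NonDependent.Propositional using (_×-↔_)
open import Data.Rational.Base hiding (_≃_)
open import Data.Rational.Properties hiding (_≟_)
open import Data.Rational.Solver using (module +-*-Solver)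
open import Data.Sum.Base using (inj₁; inj₂)
open import Data.Unit.Base using (⊤)
import Data.Vec.Functional as Vector
open import Function.Base using (_∘_)
open import Function.Bundles using (_↔_; _⇔_; module Inverse; module Equivalence)
open import Function.Construct.Composition using (_↔-∘_)
open import Function.Properties.Inverse using (↔-sym; ↔⇒↣)
open import Relation.Binary.Definitions using (DecidableEquality)
open import Relation.Binary.PropositionalEquality
  using (_≡_; refl; sym; trans; cong; cong₂; subst)
open import Relation.Nullary.Decidable.Core using (Dec; yes; no; does; _×-dec_)
open import Relation.Unary using (Decidable)
open import Data.Bool.Base using (if_then_else_)

Eventually : (ℕ → Set) → Set
Eventually P = ∃[ N ] (∀ n → N ℕ.≤ n → P n)

Cauchy : (ℕ → ℚ) → Set
Cauchy x = ∀ ε → 0ℚ < ε →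
  ∃[ N ] (∀ m n → N ℕ.≤ m → N ℕ.≤ n → ∣ x m - x n ∣ < ε)

-- Equality of reals is _≃ᴿ_, not _≡_.
record ℝ : Set where
  constructor mkℝ
  field
    seq    : ℕ → ℚ
    cauchy : Cauchy seq

open ℝ public

infix 4 _≃ᴿ_ _≤ᴿ_

_≃ᴿ_ : ℝ → ℝ → Set
x ≃ᴿ y = ∀ ε → 0ℚ < ε → Eventually λ n → ∣ seq x n - seq y n ∣ < ε

_≤ᴿ_ : ℝ → ℝ → Set
x ≤ᴿ y = ∀ ε → 0ℚ < ε → Eventually λ n → seq x n < seq y n + ε

module Cauchy-Lemmas where
  open +-*-Solver using (solve; _:=_; _:+_; _:*_; _:-_; :-_)

  _∧_ : ∀ {P Q : ℕ → Set} → Eventually P → Eventually Q →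
        Eventually (λ n → P n × Q n)
  (M , p) ∧ (N , q) = M ℕ.⊔ N , λ n le →
    p n (ℕ.m⊔n≤o⇒m≤o M N le) , q n (ℕ.m⊔n≤o⇒n≤o M N le)

  split : ∀ ε → ½ * ε + ½ * ε ≡ ε
  split ε = trans (sym (*-distribʳ-+ ε ½ ½)) (*-identityˡ ε)

  half-pos : ∀ {ε} → 0ℚ < ε → 0ℚ < ½ * ε
  half-pos {ε} p = *-monoʳ-<-pos ½ p

  shrink : ∀ {B ε} → 0ℚ < B → 0ℚ < ε → ∃[ δ ] (0ℚ < δ × B * δ ≡ ε)
  shrink {B} {ε} 0<B 0<ε =
    1/ B * ε , subst (_< 1/ B * ε) (*-zeroʳ (1/ B)) (*-monoʳ-<-pos (1/ B) 0<ε) ,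
    trans (sym (*-assoc B (1/ B) ε))
          (trans (cong (_* ε) (*-inverseʳ B)) (*-identityˡ ε))
    where
    instance
      B⁺ = positive 0<B
      B≢0 = pos⇒nonZero B
      1/B⁺ = 1/pos⇒pos B

  ∣∣-*-< : ∀ {a b B δ} → ∣ a ∣ < B → ∣ b ∣ < δ → ∣ a * b ∣ < B * δ
  ∣∣-*-< {a} {b} {B} {δ} a<B b<δ = begin-strict
    ∣ a * b ∣       ≡⟨ ∣p*q∣≡∣p∣*∣q∣ a b ⟩
    ∣ a ∣ * ∣ b ∣   ≤⟨ *-monoʳ-≤-nonNeg ∣ b ∣ {{∣-∣-nonNeg b}} (<⇒≤ a<B) ⟩
    B * ∣ b ∣       <⟨ *-monoʳ-<-pos B {{positive (≤-<-trans (0≤∣p∣ a) a<B)}} b<δ ⟩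
    B * δ           ∎
    where open ≤-Reasoning

  p≤∣p∣ : ∀ p → p ≤ ∣ p ∣
  p≤∣p∣ p with ≤-total 0ℚ p
  ... | inj₁ 0≤p = ≤-reflexive (sym (0≤p⇒∣p∣≡p 0≤p))
  ... | inj₂ p≤0 = ≤-trans p≤0 (0≤∣p∣ p)

  -∣p∣≤p : ∀ p → - ∣ p ∣ ≤ p
  -∣p∣≤p p = subst (- ∣ p ∣ ≤_) (solve 1 (λ p → :- (:- p) := p) refl p)
    (neg-antimono-≤ (subst (- p ≤_) (∣-p∣≡∣p∣ p) (p≤∣p∣ (- p))))

  bounded : ∀ x → Cauchy x → ∃[ B ] (0ℚ < B × Eventually λ n → ∣ x n ∣ < B)
  bounded x c with N , h ← c 1ℚ (positive⁻¹ 1ℚ) =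
    1ℚ + ∣ x N ∣ , +-mono-<-≤ (positive⁻¹ 1ℚ) (0≤∣p∣ (x N)) , N , λ n N≤n →
    let open ≤-Reasoning in begin-strict
    ∣ x n ∣                     ≡⟨ cong ∣_∣ (solve 2 (λ a b → a := (a :- b) :+ b) refl (x n) (x N)) ⟩
    ∣ (x n - x N) + x N ∣       ≤⟨ ∣p+q∣≤∣p∣+∣q∣ (x n - x N) (x N) ⟩
    ∣ x n - x N ∣ + ∣ x N ∣     <⟨ +-monoˡ-< ∣ x N ∣ (h n N N≤n ℕ.≤-refl) ⟩
    1ℚ + ∣ x N ∣                ∎

  ∣+-+∣< : ∀ a b c d {ε₁ ε₂} → ∣ a - c ∣ < ε₁ → ∣ b - d ∣ < ε₂ →
           ∣ (a + b) - (c + d) ∣ < ε₁ + ε₂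
  ∣+-+∣< a b c d {ε₁} {ε₂} p q = begin-strict
    ∣ (a + b) - (c + d) ∣     ≡⟨ cong ∣_∣ (rearrange a b c d) ⟩
    ∣ (a - c) + (b - d) ∣     ≤⟨ ∣p+q∣≤∣p∣+∣q∣ (a - c) (b - d) ⟩
    ∣ a - c ∣ + ∣ b - d ∣     <⟨ +-mono-< p q ⟩
    ε₁ + ε₂                   ∎
    where
    open ≤-Reasoning
    rearrange : ∀ a b c d → (a + b) - (c + d) ≡ (a - c) + (b - d)
    rearrange = solve 4 (λ a b c d → (a :+ b) :- (c :+ d) := (a :- c) :+ (b :- d)) refl

  ∣*-*∣< : ∀ a b c d {A D δ₁ δ₂} → ∣ a ∣ < A → ∣ d ∣ < D →
           ∣ a - c ∣ < δ₁ → ∣ b - d ∣ < δ₂ →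
           ∣ a * b - c * d ∣ < A * δ₂ + D * δ₁
  ∣*-*∣< a b c d {A} {D} {δ₁} {δ₂} a<A d<D p q = begin-strict
    ∣ a * b - c * d ∣                     ≡⟨ cong ∣_∣ (rearrange a b c d) ⟩
    ∣ a * (b - d) + d * (a - c) ∣         ≤⟨ ∣p+q∣≤∣p∣+∣q∣ (a * (b - d)) (d * (a - c)) ⟩
    ∣ a * (b - d) ∣ + ∣ d * (a - c) ∣     <⟨ +-mono-< (∣∣-*-< {a} {b - d} a<A q)
                                                      (∣∣-*-< {d} {a - c} d<D p) ⟩
    A * δ₂ + D * δ₁                       ∎
    where
    open ≤-Reasoning
    rearrange : ∀ a b c d → a * b - c * d ≡ a * (b - d) + d * (a - c)
    rearrange = solve 4
      (λ a b c d → a :* b :- c :* d := a :* (b :- d) :+ d :* (a :- c)) refl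

  cauchy-+ : ∀ x y → Cauchy x → Cauchy y → Cauchy (λ n → x n + y n)
  cauchy-+ x y cx cy ε 0<ε =
    let M , p = cx (½ * ε) (half-pos 0<ε)
        N , q = cy (½ * ε) (half-pos 0<ε)
    in M ℕ.⊔ N , λ m n lm ln →
    subst (∣ (x m + y m) - (x n + y n) ∣ <_) (split ε)
      (∣+-+∣< (x m) (y m) (x n) (y n)
        (p m n (ℕ.m⊔n≤o⇒m≤o M N lm) (ℕ.m⊔n≤o⇒m≤o M N ln))
        (q m n (ℕ.m⊔n≤o⇒n≤o M N lm) (ℕ.m⊔n≤o⇒n≤o M N ln)))

  cauchy-* : ∀ x y → Cauchy x → Cauchy y → Cauchy (λ n → x n * y n)
  cauchy-* x y cx cy ε 0<ε =
    let A , 0<A , K , bx = bounded x cx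
        B , 0<B , L , by = bounded y cy
        δ₁ , 0<δ₁ , eq₁ = shrink 0<B (half-pos 0<ε)
        δ₂ , 0<δ₂ , eq₂ = shrink 0<A (half-pos 0<ε)
        M , p = cx δ₁ 0<δ₁
        N , q = cy δ₂ 0<δ₂
    in (K ℕ.⊔ L) ℕ.⊔ (M ℕ.⊔ N) , λ m n lm ln →
    let lm₁ = ℕ.m⊔n≤o⇒m≤o (K ℕ.⊔ L) (M ℕ.⊔ N) lm
        ln₁ = ℕ.m⊔n≤o⇒m≤o (K ℕ.⊔ L) (M ℕ.⊔ N) ln
        lm₂ = ℕ.m⊔n≤o⇒n≤o (K ℕ.⊔ L) (M ℕ.⊔ N) lm
        ln₂ = ℕ.m⊔n≤o⇒n≤o (K ℕ.⊔ L) (M ℕ.⊔ N) ln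
    in subst (∣ x m * y m - x n * y n ∣ <_) (trans (cong₂ _+_ eq₂ eq₁) (split ε))
      (∣*-*∣< (x m) (y m) (x n) (y n)
        (bx m (ℕ.m⊔n≤o⇒m≤o K L lm₁)) (by n (ℕ.m⊔n≤o⇒n≤o K L ln₁))
        (p m n (ℕ.m⊔n≤o⇒m≤o M N lm₂) (ℕ.m⊔n≤o⇒m≤o M N ln₂))
        (q m n (ℕ.m⊔n≤o⇒n≤o M N lm₂) (ℕ.m⊔n≤o⇒n≤o M N ln₂)))

open Cauchy-Lemmas

infixl 6 _+ᴿ_
infixl 7 _*ᴿ_

_+ᴿ_ : ℝ → ℝ → ℝ
x +ᴿ y = mkℝ (λ n → seq x n + seq y n) (cauchy-+ (seq x) (seq y) (cauchy x) (cauchy y))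

_*ᴿ_ : ℝ → ℝ → ℝ
x *ᴿ y = mkℝ (λ n → seq x n * seq y n) (cauchy-* (seq x) (seq y) (cauchy x) (cauchy y))

fromℚ : ℚ → ℝ
fromℚ q = mkℝ (λ _ → q) λ ε 0<ε →
  0 , λ _ _ _ _ → subst (λ d → ∣ d ∣ < ε) (sym (+-inverseʳ q)) 0<ε

module NonNeg-Lemmas where
  open +-*-Solver using (solve; _:=_; _:+_)

  0≤-+ : ∀ x y → fromℚ 0ℚ ≤ᴿ x → fromℚ 0ℚ ≤ᴿ y → fromℚ 0ℚ ≤ᴿ x +ᴿ y
  0≤-+ x y p q ε 0<ε
    with N , h ← p (½ * ε) (half-pos 0<ε) ∧ q (½ * ε) (half-pos 0<ε) =
    N , λ n N≤n → subst (0ℚ <_)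
      (trans (solve 3 (λ a b e → (a :+ e) :+ (b :+ e) := (a :+ b) :+ (e :+ e)) refl
               (seq x n) (seq y n) (½ * ε))
             (cong (λ d → seq x n + seq y n + d) (split ε)))
      (+-mono-< (proj₁ (h n N≤n)) (proj₂ (h n N≤n)))

  neg-small : ∀ p q → p ≤ 0ℚ → 0ℚ < p + q → ∣ p ∣ < q
  neg-small p q p≤0 h = begin-strict
    ∣ p ∣           ≡⟨ ∣-p∣≡∣p∣ p ⟨
    ∣ - p ∣         ≡⟨ 0≤p⇒∣p∣≡p (neg-antimono-≤ p≤0) ⟩
    - p             ≡⟨ +-identityʳ (- p) ⟨
    - p + 0ℚ        <⟨ +-monoʳ-< (- p) h ⟩
    - p + (p + q)   ≡⟨ +-assoc (- p) p q ⟨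
    - p + p + q     ≡⟨ cong (_+ q) (+-inverseˡ p) ⟩
    0ℚ + q          ≡⟨ +-identityˡ q ⟩
    q               ∎
    where open ≤-Reasoning

  small⇒> : ∀ p {ε} → ∣ p ∣ < ε → 0ℚ < p + ε
  small⇒> p h = subst (_< p + _) (+-inverseˡ ∣ p ∣) (+-mono-≤-< (-∣p∣≤p p) h)

  *-near-pos : ∀ {a b A B η θ ε} → 0ℚ < ε → ∣ a ∣ < A → ∣ b ∣ < B →
               0ℚ < a + η → 0ℚ < b + θ → B * η ≡ ε → A * θ ≡ ε →
               0ℚ < a * b + ε
  *-near-pos {a} {b} {ε = ε} 0<ε a<A b<B a>-η b>-θ Bη≡ε Aθ≡ε
    with ≤-total 0ℚ a | ≤-total 0ℚ b
  ... | inj₁ 0≤a | inj₁ 0≤b = +-mono-≤-<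
          (nonNegative⁻¹ (a * b)
             {{nonNeg*nonNeg⇒nonNeg a {{nonNegative 0≤a}} b {{nonNegative 0≤b}}}})
          0<ε
  ... | inj₁ _ | inj₂ b≤0 = small⇒> (a * b)
          (subst (∣ a * b ∣ <_) Aθ≡ε (∣∣-*-< {a} {b} a<A (neg-small b _ b≤0 b>-θ)))
  ... | inj₂ a≤0 | _ = subst (λ p → 0ℚ < p + ε) (*-comm b a) (small⇒> (b * a)
          (subst (∣ b * a ∣ <_) Bη≡ε (∣∣-*-< {b} {a} b<B (neg-small a _ a≤0 a>-η))))

  0≤-* : ∀ x y → fromℚ 0ℚ ≤ᴿ x → fromℚ 0ℚ ≤ᴿ y → fromℚ 0ℚ ≤ᴿ x *ᴿ y
  0≤-* x y p q ε 0<ε =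
    let A , 0<A , bx = bounded (seq x) (cauchy x)
        B , 0<B , by = bounded (seq y) (cauchy y)
        η , 0<η , Bη≡ε = shrink 0<B 0<ε
        θ , 0<θ , Aθ≡ε = shrink 0<A 0<ε
        N , h = (bx ∧ by) ∧ (p η 0<η ∧ q θ 0<θ)
    in N , λ n N≤n → let ((a<A , b<B) , (a>-η , b>-θ)) = h n N≤n in
    *-near-pos {seq x n} {seq y n} 0<ε a<A b<B a>-η b>-θ Bη≡ε Aθ≡ε

open NonNeg-Lemmas

record ℝ≥0 : Set where
  constructor mkℝ≥0
  field
    val    : ℝ
    nonneg : fromℚ 0ℚ ≤ᴿ val

open ℝ≥0 public

infix  4 _≃_
infixl 6 _⊕_
infixl 7 _⊙_

_≃_ : ℝ≥0 → ℝ≥0 → Set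
r ≃ s = val r ≃ᴿ val s

_⊕_ : ℝ≥0 → ℝ≥0 → ℝ≥0
r ⊕ s = mkℝ≥0 (val r +ᴿ val s) (0≤-+ (val r) (val s) (nonneg r) (nonneg s))

_⊙_ : ℝ≥0 → ℝ≥0 → ℝ≥0
r ⊙ s = mkℝ≥0 (val r *ᴿ val s) (0≤-* (val r) (val s) (nonneg r) (nonneg s))

fromℚ≥0 : (q : ℚ) .{{_ : NonNegative q}} → ℝ≥0
fromℚ≥0 q = mkℝ≥0 (fromℚ q) λ ε 0<ε →
  0 , λ _ _ → +-mono-≤-< (nonNegative⁻¹ q) 0<ε

ratio : (m d : ℕ) .{{_ : ℕ.NonZero d}} → ℝ≥0
ratio m d = fromℚ≥0 (+ m / d) {{normalize-nonNeg m d}}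

fromℕ : ℕ → ℝ≥0
fromℕ m = ratio m 1

-- Iverson bracket
⟦_⟧ : {P : Set} → Dec P → ℝ≥0
⟦ P? ⟧ = if does P? then fromℕ 1 else fromℕ 0

record FinSet : Set₁ where
  constructor mkFinSet
  field
    Carrier : Set
    size    : ℕ
    enum    : Carrier ↔ Fin size

  infix 4 _≟_

  _≟_ : DecidableEquality Carrier
  _≟_ = inj⇒≟ (↔⇒↣ enum)

  elements : List Carrier
  elements = tabulate (Inverse.from enum)

  card : {P : Carrier → Set} → Decidable P → ℕ
  card P? = length (filter P? elements)

  ∑ : (Carrier → ℝ≥0) → ℝ≥0
  ∑ f = Vector.foldr _⊕_ (fromℕ 0) (f ∘ Inverse.from enum)

open FinSet public using (Carrier; card; ∑)

module Card-Lemmas where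
  card-pos : ∀ X {P : Carrier X → Set} (P? : Decidable P) x → P x → 0 ℕ.< card X P?
  card-pos X {P} P? x px = ∈-length (∈-filter⁺ P?
    (subst (_∈ FinSet.elements X) (Inverse.strictlyInverseʳ (FinSet.enum X) x)
      (∈-tabulate⁺ (Inverse.to (FinSet.enum X) x))) px)

  card-witness : ∀ X {P : Carrier X → Set} (P? : Decidable P) → 0 ℕ.< card X P? → ∃ P
  card-witness X P? h with filter P? (FinSet.elements X)
                         | (λ {v} → ∈-filter⁻ P? {v} {FinSet.elements X})
  ... | x ∷ _ | mem = x , proj₂ (mem (here refl))

open Card-Lemmas

infixr 7 _⊗_

_⊗_ : FinSet → FinSet → FinSet
X ⊗ Y = record
  { Carrier = Carrier X × Carrier Y
  ; size    = FinSet.size X ℕ.* FinSet.size Y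
  ; enum    = ↔-sym *↔× ↔-∘ (FinSet.enum X ×-↔ FinSet.enum Y)
  }

I : FinSet
I = record { Carrier = ⊤ ; size = 1 ; enum = ↔-sym 1↔⊤ }

-- entry f x y is f_x^y.
record Mat (X Y : FinSet) : Set where
  constructor matrix
  field
    entry : Carrier X → Carrier Y → ℝ≥0

open Mat public

infix  4 _≈_
infixr 9 _∘ᴹ_
infixr 8 _•_
infix  10 _†

_≈_ : ∀ {X Y} → Mat X Y → Mat X Y → Set
f ≈ g = ∀ x y → entry f x y ≃ entry g x y

id : ∀ {X} → Mat X X
id {X} = matrix λ x x′ → ⟦ FinSet._≟_ X x x′ ⟧

_∘ᴹ_ : ∀ {X Y Z} → Mat Y Z → Mat X Y → Mat X Z
_∘ᴹ_ {Y = Y} g f = matrix λ a c → ∑ Y λ b → entry f a b ⊙ entry g b c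

_† : ∀ {X Y} → Mat X Y → Mat Y X
f † = matrix λ y x → entry f x y

_•_ : ∀ {X Y} → ℝ≥0 → Mat X Y → Mat X Y
t • f = matrix λ x y → t ⊙ entry f x y

σ : ∀ X Y → Mat (X ⊗ Y) (Y ⊗ X)
σ X Y = matrix λ xy yx → ⟦ FinSet._≟_ (Y ⊗ X) (swap xy) yx ⟧

-- The (co)monoid and Frobenius laws are not recorded: the properties
-- below depend on the four structure maps alone.
record FrobeniusData (A : FinSet) : Set where
  field
    mult   : Mat (A ⊗ A) A
    unit   : Mat I A
    comult : Mat A (A ⊗ A)
    counit : Mat A I

module _ {A : FinSet} (F : FrobeniusData A) where
  open FrobeniusData F

  Special : Set
  Special = ∃[ t ] mult ∘ᴹ comult ≈ t • id

  Symmetric : Set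
  Symmetric = counit ∘ᴹ mult ∘ᴹ σ A A ≈ counit ∘ᴹ mult

  Extra : Set
  Extra = counit ∘ᴹ unit ≈ id

-- A partition of X × X is given as a surjection color onto the finite set S
-- of its blocks: the block p ∈ S is { (x , y) | color x y ≡ p }.
record CoherentConfiguration : Set₁ where
  field
    X S      : FinSet
    color    : Carrier X → Carrier X → Carrier S
    nonempty : ∀ p → ∃₂ λ x y → color x y ≡ p

  private
    infix 4 _≟_
    _≟_ = FinSet._≟_ S

  -- the number of z with (x , z) ∈ a and (z , y) ∈ b
  paths : (a b : Carrier S) (x y : Carrier X) → ℕ
  paths a b x y = card X λ z → (color x z ≟ a) ×-dec (color z y ≟ b)

  field
    diagonal : ∀ {p x} → color x x ≡ p → ∀ {y z} → color y z ≡ p → y ≡ z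
    regular  : ∀ a b {x y x′ y′} → color x y ≡ color x′ y′ →
               paths a b x y ≡ paths a b x′ y′
    converse : ∀ c → ∃[ d ] (∀ x y → color x y ≡ c ⇔ color y x ≡ d)

  infix 10 _⁻¹

  _⁻¹ : Carrier S → Carrier S
  a ⁻¹ = proj₁ (converse a)

  -- ∇ a b c is ∇_{ab}^c; by regular, the chosen pair in c is immaterial.
  ∇ : (a b c : Carrier S) → ℕ
  ∇ a b c = let (x , y , _) = nonempty c in paths a b x y

  IsUnit : Carrier S → Set
  IsUnit p = ∀ {x y} → color x y ≡ p → x ≡ y

  isUnit? : Decidable IsUnit
  isUnit? p with x , y , refl ← nonempty p with FinSet._≟_ X x y
  ... | yes refl = yes (diagonal refl)
  ... | no x≢y   = no λ unit → x≢y (unit refl)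

  source-exists : ∀ a → ∃! _≡_ λ q → IsUnit q × 0 ℕ.< ∇ a (a ⁻¹) q
  source-exists a with x , y , xy∈a ← nonempty a =
    color x x , (diagonal refl , positive′) , unique
    where
    positive′ : 0 ℕ.< ∇ a (a ⁻¹) (color x x)
    positive′ = subst (0 ℕ.<_)
      (regular a (a ⁻¹) (sym (proj₂ (proj₂ (nonempty (color x x))))))
      (card-pos X _ y (xy∈a , Equivalence.to (proj₂ (converse a) x y) xy∈a))

    unique : ∀ {q′} → IsUnit q′ × 0 ℕ.< ∇ a (a ⁻¹) q′ → color x x ≡ q′
    unique {q′} (unit , pos) with u , v , uv∈q ← nonempty q′
      with refl ← unit uv∈q
      with z , uz∈a , _ ← card-witness X _ pos
      with w , uw∈q , _ ← card-witness X
             (λ w → (color u w ≟ color x x) ×-dec (color w z ≟ a))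
             (subst (0 ℕ.<_) (regular (color x x) a (trans xy∈a (sym uz∈a)))
               (card-pos X _ x (refl , xy∈a)))
      with refl ← diagonal refl uw∈q = trans (sym uw∈q) uv∈q

  source : Carrier S → Carrier S
  source a = proj₁ (source-exists a)

  ‖_‖ : Carrier S → ℕ
  ‖ a ‖ = ∇ a (a ⁻¹) (source a)

  instance
    ‖‖-nonZero : ∀ {a} → ℕ.NonZero ‖ a ‖
    ‖‖-nonZero {a} = ℕ.>-nonZero (proj₂ (proj₁ (proj₂ (source-exists a))))

  -- |p| as a subset of X × X
  blockSize : Carrier S → ℕ
  blockSize p = card (X ⊗ X) λ (x , y) → color x y ≟ p

  frobenius : FrobeniusData S
  frobenius = record
    { mult   = matrix λ (a , b) c → fromℕ (∇ a b c)
    ; unit   = e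
    ; comult = matrix λ a (b , c) → ratio (∇ (b ⁻¹) a c) ‖ b ⁻¹ ‖
    ; counit = e †
    }
    where
    e : Mat I S
    e = matrix λ _ a → ⟦ isUnit? a ⟧

  Thin : Set
  Thin = ∀ a → ‖ a ‖ ≡ 1

  ½-Homogeneous : Set
  ½-Homogeneous = ∀ p q → IsUnit p → IsUnit q → blockSize p ≡ blockSize q

  IsAssociationScheme : Set
  IsAssociationScheme = ∃[ p ] (∀ x y → color x y ≡ p ⇔ x ≡ y)

open CoherentConfiguration public
  using (frobenius; Thin; ½-Homogeneous; IsAssociationScheme)

{-# OPTIONS --safe #-}
module Submission where

-- For (x , y) ∈ d, the entry of ∇ ∘ Δ from a to d is the sum over z ∈ X of
-- #{ w : color w z = b, (w , y) ∈ a } / ‖ b⁻¹ ‖, where b = color x z. In a thin configuration only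
-- w = x contributes, so ∇ ∘ Δ = |X| · id. Conversely, if color x y = color x z, then the path
-- z → x → y → z makes the entry from color y z to color z z positive, so if ∇ ∘ Δ = t · id these two
-- colors agree and y = z.
--
-- The entry of e† ∘ ∇ at (a , b) is ‖ a ‖ if b = a⁻¹ and 0 otherwise, so symmetry means
-- ‖ a ‖ = ‖ a⁻¹ ‖ for all a. Counting the pairs in a from either side gives
-- |s(a)| · ‖ a ‖ = |s(a⁻¹)| · ‖ a⁻¹ ‖, and any two unit colors are s(a) and s(a⁻¹) for some a.
--
-- Finally e† ∘ e is the number of unit colors, whose union is the diagonal.
--
-- All matrix entries but the scalar t are constant Cauchy sequences, which reduces equality of reals to
-- equality of rational or natural numbers.

open import Defs
open import Data.Bool.Base using (if_then_else_; true; false)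
open import Data.Fin.Base using (Fin; zero; suc)
open import Data.Fin.Properties using (punchInᵢ≢i)
open import Data.Integer.Base as ℤ using ()
import Data.Integer.Properties as ℤ
open import Data.List.Base using (_∷_; []; length; filter; tabulate)
open import Data.List.Membership.Propositional using (_∈_)
open import Data.List.Membership.Propositional.Properties using (∈-tabulate⁺; ∈-filter⁺)
open import Data.List.Relation.Unary.Any using (here)
open import Data.Nat.Base as ℕ using (ℕ; zero; suc; _+_; _*_)
import Data.Nat.Properties as ℕ
open import Data.Product.Base using (∃-syntax; _×_; _,_; proj₁; proj₂; swap)
open import Data.Rational.Base as ℚ using (ℚ; 0ℚ; toℚᵘ)
import Data.Rational.Properties as ℚ
open import Data.Rational.Unnormalised.Base as ℚᵘ using (mkℚᵘ; *≡*)
import Data.Rational.Unnormalised.Properties as ℚᵘ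
open import Data.Unit.Base using (tt)
import Data.Vec.Functional as Vector
open import Function.Base using (_∘_)
open import Function.Bundles using (_⇔_; mk⇔; module Inverse; module Equivalence)
open import Function.Construct.Composition using (_⇔-∘_)
open import Relation.Binary.PropositionalEquality
  using (_≡_; _≢_; refl; sym; trans; cong; cong₂; subst; module ≡-Reasoning)
open import Relation.Nullary.Decidable
  using (Dec; yes; no; does; does-⇔; dec-true; dec-false; decidable-stable)
open import Relation.Nullary.Negation using (¬_; contradiction)
open import Relation.Unary using (Decidable)
open import Algebra.Properties.Semiring.Sum ℕ.+-*-semiring
  using (sum; sum-cong-≗; sum-replicate-zero; sum-remove; ∑-comm; *-distribʳ-sum)

open Equivalence using (to; from)

-- Indicator functions, finite sums of naturals and cardinalities.

χ : {P : Set} → Dec P → ℕ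
χ P? = if does P? then 1 else 0

χ-cong : {P Q : Set} → P ⇔ Q → (P? : Dec P) (Q? : Dec Q) → χ P? ≡ χ Q?
χ-cong P⇔Q P? Q? = cong (λ b → if b then 1 else 0) (does-⇔ P⇔Q P? Q?)

χ-true : {P : Set} (P? : Dec P) → P → χ P? ≡ 1
χ-true P? p = cong (λ b → if b then 1 else 0) (dec-true P? p)

χ-false : {P : Set} (P? : Dec P) → ¬ P → χ P? ≡ 0
χ-false P? ¬p = cong (λ b → if b then 1 else 0) (dec-false P? ¬p)

sum-single : ∀ {n} (f : Fin n → ℕ) i → (∀ j → j ≢ i → f j ≡ 0) → sum f ≡ f i
sum-single {suc n} f i f≡0 = begin
  sum f                             ≡⟨ sum-remove f ⟩
  f i + sum (Vector.removeAt f i)   ≡⟨ cong (f i +_) (sum-cong-≗ λ j → f≡0 _ (punchInᵢ≢i i j)) ⟩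
  f i + sum (Vector.replicate n 0)  ≡⟨ cong (f i +_) (sum-replicate-zero n) ⟩
  f i + 0                           ≡⟨ ℕ.+-identityʳ (f i) ⟩
  f i                               ∎
  where open ≡-Reasoning

length-filter-tabulate : ∀ {A : Set} {P : A → Set} (P? : Decidable P) {n} (f : Fin n → A) →
  length (filter P? (tabulate f)) ≡ sum (λ i → χ (P? (f i)))
length-filter-tabulate P? {zero}  f = refl
length-filter-tabulate P? {suc n} f with does (P? (f zero))
... | true  = cong suc (length-filter-tabulate P? (f ∘ suc))
... | false = length-filter-tabulate P? (f ∘ suc)

module _ (X : FinSet) where
  private
    at = Inverse.from (FinSet.enum X)
    index = Inverse.to (FinSet.enum X)

    at-index : ∀ x → at (index x) ≡ x
    at-index = Inverse.strictlyInverseʳ (FinSet.enum X)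

    index-at : ∀ i → index (at i) ≡ i
    index-at = Inverse.strictlyInverseˡ (FinSet.enum X)

  ∑ℕ : (Carrier X → ℕ) → ℕ
  ∑ℕ f = sum (f ∘ at)

  ∑ℕ-cong : ∀ {f g : Carrier X → ℕ} → (∀ x → f x ≡ g x) → ∑ℕ f ≡ ∑ℕ g
  ∑ℕ-cong f≡g = sum-cong-≗ (f≡g ∘ at)

  ∑ℕ-*ʳ : ∀ m (f : Carrier X → ℕ) → ∑ℕ f * m ≡ ∑ℕ (λ x → f x * m)
  ∑ℕ-*ʳ m f = *-distribʳ-sum m (f ∘ at)

  ∑ℕ-zero : ∀ {f : Carrier X → ℕ} → (∀ x → f x ≡ 0) → ∑ℕ f ≡ 0
  ∑ℕ-zero f≡0 = trans (∑ℕ-cong f≡0) (sum-replicate-zero (FinSet.size X))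

  ∑ℕ-single : ∀ (f : Carrier X → ℕ) x → (∀ y → y ≢ x → f y ≡ 0) → ∑ℕ f ≡ f x
  ∑ℕ-single f x f≡0 = trans
    (sum-single (f ∘ at) (index x) λ j j≢ →
      f≡0 (at j) λ { refl → j≢ (sym (index-at j)) })
    (cong f (at-index x))

  ∑ℕ-χ-* : ∀ (f : Carrier X → ℕ) x → ∑ℕ (λ y → χ (FinSet._≟_ X x y) * f y) ≡ f x
  ∑ℕ-χ-* f x = trans
    (∑ℕ-single _ x λ y y≢x → cong (_* f y) (χ-false (FinSet._≟_ X x y) (y≢x ∘ sym)))
    (trans (cong (_* f x) (χ-true (FinSet._≟_ X x x) refl)) (ℕ.+-identityʳ (f x)))

  card-∑ℕ : ∀ {P : Carrier X → Set} (P? : Decidable P) → card X P? ≡ ∑ℕ (λ x → χ (P? x))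
  card-∑ℕ P? = length-filter-tabulate P? at

  card-cong : ∀ {P Q : Carrier X → Set} (P? : Decidable P) (Q? : Decidable Q) →
    (∀ x → P x ⇔ Q x) → card X P? ≡ card X Q?
  card-cong P? Q? P⇔Q = begin
    card X P?                ≡⟨ card-∑ℕ P? ⟩
    ∑ℕ (λ x → χ (P? x))      ≡⟨ ∑ℕ-cong (λ x → χ-cong (P⇔Q x) (P? x) (Q? x)) ⟩
    ∑ℕ (λ x → χ (Q? x))      ≡⟨ card-∑ℕ Q? ⟨
    card X Q?                ∎
    where open ≡-Reasoning

  card-none : ∀ {P : Carrier X → Set} (P? : Decidable P) → (∀ x → ¬ P x) → card X P? ≡ 0
  card-none P? ¬P = trans (card-∑ℕ P?) (∑ℕ-zero λ x → χ-false (P? x) (¬P x))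

  card-unique : ∀ {P : Carrier X → Set} (P? : Decidable P) x → P x →
    (∀ y → P y → y ≡ x) → card X P? ≡ 1
  card-unique P? x px unique = begin
    card X P?               ≡⟨ card-∑ℕ P? ⟩
    ∑ℕ (λ y → χ (P? y))     ≡⟨ ∑ℕ-single _ x (λ y y≢x → χ-false (P? y) (y≢x ∘ unique y)) ⟩
    χ (P? x)                ≡⟨ χ-true (P? x) px ⟩
    1                       ∎
    where open ≡-Reasoning

  ∈-filter-elements : ∀ {P : Carrier X → Set} (P? : Decidable P) {x} → P x →
    x ∈ filter P? (FinSet.elements X)
  ∈-filter-elements P? {x} px =
    ∈-filter⁺ P? (subst (_∈ FinSet.elements X) (at-index x) (∈-tabulate⁺ (index x))) px

  card≡1⇒unique : ∀ {P : Carrier X → Set} (P? : Decidable P) → card X P? ≡ 1 →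
    ∀ {x y} → P x → P y → x ≡ y
  card≡1⇒unique P? eq px py
    with filter P? (FinSet.elements X) | ∈-filter-elements P? px | ∈-filter-elements P? py
  ... | _ ∷ [] | here x≡z | here y≡z = trans x≡z (sym y≡z)

∑ℕ-comm : ∀ X Y (f : Carrier X → Carrier Y → ℕ) →
  ∑ℕ X (λ x → ∑ℕ Y (f x)) ≡ ∑ℕ Y (λ y → ∑ℕ X λ x → f x y)
∑ℕ-comm X Y f = ∑-comm λ i j → f (Inverse.from (FinSet.enum X) i) (Inverse.from (FinSet.enum Y) j)

-- Writing `h (φ x)` as a sum over `y` of `χ (φ x ≟ y) * h y` and exchanging the two sums groups the
-- points of `X` by their image. This turns sums over colors or pairs into sums over points.
∑ℕ-fibres : ∀ X Y (φ : Carrier X → Carrier Y) (h : Carrier Y → ℕ) →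
  ∑ℕ X (h ∘ φ) ≡ ∑ℕ Y (λ y → card X (λ x → FinSet._≟_ Y (φ x) y) * h y)
∑ℕ-fibres X Y φ h = begin
  ∑ℕ X (h ∘ φ)
    ≡⟨ ∑ℕ-cong X (λ x → ∑ℕ-χ-* Y h (φ x)) ⟨
  ∑ℕ X (λ x → ∑ℕ Y λ y → χ (φ x ≟ y) * h y)
    ≡⟨ ∑ℕ-comm X Y (λ x y → χ (φ x ≟ y) * h y) ⟩
  ∑ℕ Y (λ y → ∑ℕ X λ x → χ (φ x ≟ y) * h y)
    ≡⟨ ∑ℕ-cong Y (λ y → ∑ℕ-*ʳ X (h y) (λ x → χ (φ x ≟ y))) ⟨
  ∑ℕ Y (λ y → ∑ℕ X (λ x → χ (φ x ≟ y)) * h y)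
    ≡⟨ ∑ℕ-cong Y (λ y → cong (_* h y) (card-∑ℕ X (λ x → φ x ≟ y))) ⟨
  ∑ℕ Y (λ y → card X (λ x → φ x ≟ y) * h y)
    ∎
  where
  open ≡-Reasoning
  open FinSet Y using (_≟_)

-- Naturals inside the rationals.

ι : ℕ → ℚ
ι m = ℤ.+ m ℚ./ 1

toℚᵘ-ι : ∀ m → toℚᵘ (ι m) ℚᵘ.≃ mkℚᵘ (ℤ.+ m) 0
toℚᵘ-ι m = ℚ.toℚᵘ-fromℚᵘ (mkℚᵘ (ℤ.+ m) 0)

ι-+ : ∀ m n → ι m ℚ.+ ι n ≡ ι (m + n)
ι-+ m n = ℚ.toℚᵘ-injective (begin-equality
  toℚᵘ (ι m ℚ.+ ι n)              ≃⟨ ℚ.toℚᵘ-homo-+ (ι m) (ι n) ⟩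
  toℚᵘ (ι m) ℚᵘ.+ toℚᵘ (ι n)      ≃⟨ ℚᵘ.+-cong (toℚᵘ-ι m) (toℚᵘ-ι n) ⟩
  mkℚᵘ (ℤ.+ m) 0 ℚᵘ.+ mkℚᵘ (ℤ.+ n) 0
    ≡⟨ cong₂ (λ i j → mkℚᵘ (i ℤ.+ j) 0) (ℤ.*-identityʳ (ℤ.+ m)) (ℤ.*-identityʳ (ℤ.+ n)) ⟩
  mkℚᵘ (ℤ.+ (m + n)) 0              ≃⟨ toℚᵘ-ι (m + n) ⟨
  toℚᵘ (ι (m + n))                ∎)
  where open ℚᵘ.≤-Reasoning

ι-* : ∀ m n → ι m ℚ.* ι n ≡ ι (m * n)
ι-* m n = ℚ.toℚᵘ-injective (begin-equality
  toℚᵘ (ι m ℚ.* ι n)              ≃⟨ ℚ.toℚᵘ-homo-* (ι m) (ι n) ⟩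
  toℚᵘ (ι m) ℚᵘ.* toℚᵘ (ι n)      ≃⟨ ℚᵘ.*-cong (toℚᵘ-ι m) (toℚᵘ-ι n) ⟩
  mkℚᵘ (ℤ.+ m) 0 ℚᵘ.* mkℚᵘ (ℤ.+ n) 0  ≡⟨ cong (λ i → mkℚᵘ i 0) (ℤ.pos-* m n) ⟨
  mkℚᵘ (ℤ.+ (m * n)) 0              ≃⟨ toℚᵘ-ι (m * n) ⟨
  toℚᵘ (ι (m * n))                ∎)
  where open ℚᵘ.≤-Reasoning

ι-injective : ∀ {m n} → ι m ≡ ι n → m ≡ n
ι-injective {m} {n} eq with *≡* eq′ ← ℚ./-injective-≃ (mkℚᵘ (ℤ.+ m) 0) (mkℚᵘ (ℤ.+ n) 0) eq =
  ℤ.+-injective (trans (sym (ℤ.*-identityʳ (ℤ.+ m))) (trans eq′ (ℤ.*-identityʳ (ℤ.+ n))))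

-- Constant reals and matrices with natural entries.

infix 4 _≐_

_≐_ : ℝ≥0 → ℚ → Set
r ≐ q = ∀ n → seq (val r) n ≡ q

≐⇒≃ : ∀ {r s q} → r ≐ q → s ≐ q → r ≃ s
≐⇒≃ {q = q} r≐q s≐q ε 0<ε = 0 , λ n _ → subst (ℚ._< ε)
  (sym (cong ℚ.∣_∣ (trans (cong₂ ℚ._-_ (r≐q n) (s≐q n)) (ℚ.+-inverseʳ q)))) 0<ε

-- If `p` and `q` differed, taking `∣ p - q ∣` itself as the tolerance would make this constant
-- distance smaller than itself.
≃⇒≡ : ∀ {r s p q} → r ≐ p → s ≐ q → r ≃ s → p ≡ q
≃⇒≡ {r} {s} {p} {q} r≐p s≐q r≃s with p ℚ.≟ q
... | yes p≡q = p≡q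
... | no  p≢q =
  contradiction (subst (ℚ._< ℚ.∣ p ℚ.- q ∣) distance (close N ℕ.≤-refl)) (ℚ.<-irrefl refl)
  where
  open import Algebra.Properties.Group ℚ.+-0-group using (x∙y⁻¹≈ε⇒x≈y)
  0<∣p-q∣ : 0ℚ ℚ.< ℚ.∣ p ℚ.- q ∣
  0<∣p-q∣ = ℚ.≰⇒> λ ≤0 → p≢q (x∙y⁻¹≈ε⇒x≈y p q
    (ℚ.∣p∣≡0⇒p≡0 (p ℚ.- q) (ℚ.≤-antisym ≤0 (ℚ.0≤∣p∣ (p ℚ.- q)))))
  N = proj₁ (r≃s _ 0<∣p-q∣)
  close = proj₂ (r≃s _ 0<∣p-q∣)
  distance : ℚ.∣ seq (val r) N ℚ.- seq (val s) N ∣ ≡ ℚ.∣ p ℚ.- q ∣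
  distance = cong₂ (λ a b → ℚ.∣ a ℚ.- b ∣) (r≐p N) (s≐q N)

-- These relations are records rather than synonyms so that their arguments can be inferred.
infix 4 _≐ℕ_ _≈ℕ_

record _≐ℕ_ (r : ℝ≥0) (m : ℕ) : Set where
  constructor constantly
  field
    constant : r ≐ ι m

open _≐ℕ_

record _≈ℕ_ {X Y} (f : Mat X Y) (F : Carrier X → Carrier Y → ℕ) : Set where
  constructor entrywise
  field
    entries : ∀ x y → entry f x y ≐ℕ F x y

open _≈ℕ_

fromℕ-≐ : ∀ m → fromℕ m ≐ℕ m
fromℕ-≐ m = constantly λ _ → refl

-- The denominator will be a valency, which thinness makes 1.
ratio-≐ : ∀ m d .{{_ : ℕ.NonZero d}} → d ≡ 1 → ratio m d ≐ℕ m
ratio-≐ m _ refl = fromℕ-≐ m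

⟦⟧-≐ : {P : Set} (P? : Dec P) → ⟦ P? ⟧ ≐ℕ χ P?
⟦⟧-≐ P? with does P?
... | true  = fromℕ-≐ 1
... | false = fromℕ-≐ 0

⊙-≐ : ∀ {r s m n} → r ≐ℕ m → s ≐ℕ n → r ⊙ s ≐ℕ m * n
⊙-≐ {m = m} {n} (constantly r≐m) (constantly s≐n) =
  constantly λ k → trans (cong₂ ℚ._*_ (r≐m k) (s≐n k)) (ι-* m n)

∑-≐ : ∀ X {f : Carrier X → ℝ≥0} {g : Carrier X → ℕ} → (∀ x → f x ≐ℕ g x) → ∑ X f ≐ℕ ∑ℕ X g
∑-≐ X f≐g = go λ i → f≐g (Inverse.from (FinSet.enum X) i)
  where
  go : ∀ {k} {f : Fin k → ℝ≥0} {g : Fin k → ℕ} → (∀ i → f i ≐ℕ g i) →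
    Vector.foldr _⊕_ (fromℕ 0) f ≐ℕ sum g
  go {zero}          _   = fromℕ-≐ 0
  go {suc k} {g = g} f≐g = constantly λ n →
    trans (cong₂ ℚ._+_ (constant (f≐g zero) n) (constant (go (f≐g ∘ suc)) n)) (ι-+ (g zero) _)

id-≈ : ∀ {X} → id {X} ≈ℕ λ x y → χ (FinSet._≟_ X x y)
id-≈ {X} = entrywise λ x y → ⟦⟧-≐ (FinSet._≟_ X x y)

σ-≈ : ∀ {X Y} → σ X Y ≈ℕ λ p q → χ (FinSet._≟_ (Y ⊗ X) (swap p) q)
σ-≈ {X} {Y} = entrywise λ p q → ⟦⟧-≐ (FinSet._≟_ (Y ⊗ X) (swap p) q)

•-≈ : ∀ {X Y} {f : Mat X Y} {F} m → f ≈ℕ F → fromℕ m • f ≈ℕ λ x y → m * F x y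
•-≈ {f = f} {F} m (entrywise f≐F) = entrywise λ x y →
  ⊙-≐ {fromℕ m} {entry f x y} {m} {F x y} (fromℕ-≐ m) (f≐F x y)

∘ᴹ-≈ : ∀ {X Y Z} (g : Mat Y Z) (f : Mat X Y) {G F} → g ≈ℕ G → f ≈ℕ F →
  g ∘ᴹ f ≈ℕ λ x z → ∑ℕ Y λ y → F x y * G y z
∘ᴹ-≈ {Y = Y} g f {G} {F} (entrywise g≐G) (entrywise f≐F) = entrywise λ x z →
  ∑-≐ Y {λ y → entry f x y ⊙ entry g y z} {λ y → F x y * G y z} λ y →
    ⊙-≐ {entry f x y} {entry g y z} {F x y} {G y z} (f≐F x y) (g≐G y z)

-- This moves each matrix equation with natural entries out of the reals; what remains is counting.
≈⇔≡ : ∀ {X Y} {f g : Mat X Y} {F G} → f ≈ℕ F → g ≈ℕ G → (f ≈ g) ⇔ (∀ x y → F x y ≡ G x y)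
≈⇔≡ {f = f} {g} f≈F g≈G = mk⇔
  (λ f≈g x y → ι-injective
    (≃⇒≡ {entry f x y} {entry g x y}
      (constant (entries f≈F x y)) (constant (entries g≈G x y)) (f≈g x y)))
  (λ F≡G x y → ≐⇒≃ {entry f x y} {entry g x y}
    (λ n → trans (constant (entries f≈F x y) n) (cong ι (F≡G x y))) (constant (entries g≈G x y)))

-- Without thinness the comultiplication has rational entries. Bounding a sum below by a single term
-- is enough to show that an entry of the composite is positive.
∑-upper-bound : ∀ X {f : Carrier X → ℝ≥0} {g : Carrier X → ℚ} → (∀ x → f x ≐ g x) →
  (∀ x → 0ℚ ℚ.≤ g x) → ∃[ q ] (∑ X f ≐ q × (∀ x → g x ℚ.≤ q))
∑-upper-bound X {f} {g} f≐g 0≤g =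
  let q , ∑≐q , _ , bound = go (f≐g ∘ at) (0≤g ∘ at)
  in q , ∑≐q , λ x → subst (λ y → g y ℚ.≤ q) (Inverse.strictlyInverseʳ (FinSet.enum X) x)
                       (bound (Inverse.to (FinSet.enum X) x))
  where
  at = Inverse.from (FinSet.enum X)
  -- The induction carries `0ℚ ≤ q` along, because the bound on the head term uses that the tail is
  -- non-negative.
  go : ∀ {k} {f : Fin k → ℝ≥0} {g : Fin k → ℚ} → (∀ i → f i ≐ g i) → (∀ i → 0ℚ ℚ.≤ g i) →
    ∃[ q ] (Vector.foldr _⊕_ (fromℕ 0) f ≐ q × 0ℚ ℚ.≤ q × (∀ i → g i ℚ.≤ q))
  go {zero}          _   _   = 0ℚ , (λ _ → refl) , ℚ.≤-refl , λ ()
  go {suc k} {g = g} f≐g 0≤g =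
    let q , ∑≐q , 0≤q , bound = go (f≐g ∘ suc) (0≤g ∘ suc)
        q≤g+q = subst (ℚ._≤ g zero ℚ.+ q) (ℚ.+-identityˡ q) (ℚ.+-monoˡ-≤ q (0≤g zero))
    in g zero ℚ.+ q , (λ n → cong₂ ℚ._+_ (f≐g zero n) (∑≐q n)) , ℚ.≤-trans 0≤q q≤g+q ,
       λ { zero → subst (ℚ._≤ g zero ℚ.+ q) (ℚ.+-identityʳ (g zero)) (ℚ.+-monoʳ-≤ (g zero) 0≤q)
         ; (suc i) → ℚ.≤-trans (bound i) q≤g+q }

ratio-*-ι-nonNeg : ∀ m d n .{{_ : ℕ.NonZero d}} → 0ℚ ℚ.≤ (ℤ.+ m ℚ./ d) ℚ.* ι n
ratio-*-ι-nonNeg m d n = ℚ.nonNegative⁻¹ _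
  {{ℚ.nonNeg*nonNeg⇒nonNeg (ℤ.+ m ℚ./ d) {{ℚ.normalize-nonNeg m d}} (ι n) {{ℚ.normalize-nonNeg n 1}}}}

ratio-*-ι-pos : ∀ m d n .{{_ : ℕ.NonZero d}} → 0 ℕ.< m → 0 ℕ.< n → 0ℚ ℚ.< (ℤ.+ m ℚ./ d) ℚ.* ι n
ratio-*-ι-pos m d n 0<m 0<n = ℚ.positive⁻¹ _
  {{ℚ.pos*pos⇒pos (ℤ.+ m ℚ./ d) {{m/d-pos}} (ι n) {{n-pos}}}}
  where
  m/d-pos = let instance _ = ℕ.>-nonZero 0<m in ℚ.normalize-pos m d
  n-pos = let instance _ = ℕ.>-nonZero 0<n in ℚ.normalize-pos n 1

-- Converses, sources and valencies of colors.

module _ (C : CoherentConfiguration) where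
  open CoherentConfiguration C
    hiding (frobenius; Thin; ½-Homogeneous; IsAssociationScheme)
  open FinSet S using (_≟_)
  open FrobeniusData
  open ≡-Reasoning

  mult-≈ : mult (frobenius C) ≈ℕ λ p c → ∇ (proj₁ p) (proj₂ p) c
  mult-≈ = entrywise λ p c → fromℕ-≐ (∇ (proj₁ p) (proj₂ p) c)

  unit-≈ : unit (frobenius C) ≈ℕ λ _ a → χ (isUnit? a)
  unit-≈ = entrywise λ _ a → ⟦⟧-≐ (isUnit? a)

  counit-≈ : counit (frobenius C) ≈ℕ λ a _ → χ (isUnit? a)
  counit-≈ = entrywise λ a _ → ⟦⟧-≐ (isUnit? a)

  color-converse : ∀ {x y a} → color x y ≡ a → color y x ≡ a ⁻¹
  color-converse {x} {y} {a} = to (proj₂ (converse a) x y)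

  color-converse⁻ : ∀ {x y a} → color y x ≡ a ⁻¹ → color x y ≡ a
  color-converse⁻ {x} {y} {a} = from (proj₂ (converse a) x y)

  ⁻¹-involutive : ∀ a → (a ⁻¹) ⁻¹ ≡ a
  ⁻¹-involutive a with x , y , refl ← nonempty a = sym (color-converse (color-converse refl))

  ∇-paths : ∀ a b {x y c} → color x y ≡ c → ∇ a b c ≡ paths a b x y
  ∇-paths a b {c = c} xy∈c = regular a b (trans (proj₂ (proj₂ (nonempty c))) (sym xy∈c))

  ∇-pos : ∀ {a b c x y} z → color x y ≡ c → color x z ≡ a → color z y ≡ b → 0 ℕ.< ∇ a b c
  ∇-pos {a} {b} z xy∈c xz∈a zy∈b = subst (0 ℕ.<_) (sym (∇-paths a b xy∈c))
    (Card-Lemmas.card-pos X _ z (xz∈a , zy∈b))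

  -- The loop at `x` has a unit color, and the path from `x` to `y` and back meets the condition
  -- that determines the source.
  color-source : ∀ {x y a} → color x y ≡ a → source a ≡ color x x
  color-source {x} {y} {a} xy∈a = proj₂ (proj₂ (source-exists a))
    (diagonal refl , ∇-pos y refl xy∈a (color-converse xy∈a))

  source-unit : ∀ a → IsUnit (source a)
  source-unit a = proj₁ (proj₁ (proj₂ (source-exists a)))

  outDegree : Carrier S → Carrier X → ℕ
  outDegree a x = card X λ y → color x y ≟ a

  -- A step in `a` returns in `a ⁻¹`, so the neighbours along `a` are exactly the midpoints of the
  -- paths counted by `‖ a ‖`.
  outDegree-valency : ∀ {a x} → color x x ≡ source a → outDegree a x ≡ ‖ a ‖
  outDegree-valency {a} {x} xx∈s = trans
    (card-cong X _ _ λ y → mk⇔ (λ xy∈a → xy∈a , color-converse xy∈a) proj₁)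
    (sym (∇-paths a (a ⁻¹) xx∈s))

  -- Special structures and thin configurations.

  -- The out-degree of `color x z` at `x` is its valency, hence 1, and both `y` and `z` are counted
  -- in it.
  thin-functional : Thin C → ∀ {x y z} → color x y ≡ color x z → y ≡ z
  thin-functional thin {x} {y} {z} xy≡xz = card≡1⇒unique X (λ w → color x w ≟ color x z)
    (trans (outDegree-valency (sym (color-source refl))) (thin (color x z))) xy≡xz refl

  functional-thin : (∀ {x y z} → color x y ≡ color x z → y ≡ z) → Thin C
  functional-thin functional a = let x , y , xy∈a = nonempty a in trans
    (sym (outDegree-valency (sym (color-source xy∈a))))
    (card-unique X _ y xy∈a λ z xz∈a → functional (trans xz∈a (sym xy∈a)))

  module _ (thin : Thin C) where
    -- The point `x` is reached from `z` along `color x z ⁻¹`, and by thinness it is the only one.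
    -- The count therefore asks only whether the second step, from `x` to `y`, has color `a`.
    ∇-thin : ∀ a x y z → ∇ (color x z ⁻¹) a (color z y) ≡ χ (color x y ≟ a)
    ∇-thin a x y z = trans (∇-paths (color x z ⁻¹) a refl) (paths-thin (color x y ≟ a))
      where
      zw∈⇒w≡x : ∀ {w} → color z w ≡ color x z ⁻¹ → w ≡ x
      zw∈⇒w≡x zw∈ = thin-functional thin (trans zw∈ (sym (color-converse refl)))

      -- The decision is taken as an argument so that `χ` reduces by matching on it.
      paths-thin : (xy∈a? : Dec (color x y ≡ a)) → paths (color x z ⁻¹) a z y ≡ χ xy∈a?
      paths-thin (yes xy∈a) = card-unique X _ x (color-converse refl , xy∈a) λ w → zw∈⇒w≡x ∘ proj₁
      paths-thin (no  xy∉a) = card-none X _ λ { w (zw∈ , wy∈a) →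
        xy∉a (subst (λ v → color v y ≡ a) (zw∈⇒w≡x zw∈) wy∈a) }

    -- For a fixed pair `(x , y)` in `d`, the factor `∇ b c d` counts the `z` with `φ z ≡ (b , c)`.
    -- Regrouping over `z` leaves one term `∇ (color x z ⁻¹) a (color z y)` per point, and by
    -- `∇-thin` none of these depends on `z`.
    ∑-∇-∇ : ∀ a d → ∑ℕ (S ⊗ S) (λ (b , c) → ∇ (b ⁻¹) a c * ∇ b c d)
                  ≡ ∑ℕ X (λ _ → 1) * χ (a ≟ d)
    ∑-∇-∇ a d = begin
      ∑ℕ (S ⊗ S) (λ (b , c) → ∇ (b ⁻¹) a c * ∇ b c d)
        ≡⟨ ∑ℕ-cong (S ⊗ S) (λ (b , c) → trans (ℕ.*-comm (∇ (b ⁻¹) a c) (∇ b c d))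
             (cong (_* ∇ (b ⁻¹) a c) (count b c))) ⟩
      ∑ℕ (S ⊗ S) (λ p → card X (λ z → FinSet._≟_ (S ⊗ S) (φ z) p) * h p)
        ≡⟨ ∑ℕ-fibres X (S ⊗ S) φ h ⟨
      ∑ℕ X (h ∘ φ)
        ≡⟨ ∑ℕ-cong X (λ z → trans (∇-thin a x y z) (χ-cong xy∈a⇔a≡d (color x y ≟ a) (a ≟ d))) ⟩
      ∑ℕ X (λ _ → χ (a ≟ d))
        ≡⟨ ∑ℕ-cong X (λ _ → ℕ.*-identityˡ (χ (a ≟ d))) ⟨
      ∑ℕ X (λ _ → 1 * χ (a ≟ d))
        ≡⟨ ∑ℕ-*ʳ X (χ (a ≟ d)) (λ _ → 1) ⟨
      ∑ℕ X (λ _ → 1) * χ (a ≟ d)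
        ∎
      where
      x = proj₁ (nonempty d)
      y = proj₁ (proj₂ (nonempty d))
      xy∈d : color x y ≡ d
      xy∈d = proj₂ (proj₂ (nonempty d))
      φ : Carrier X → Carrier (S ⊗ S)
      φ z = color x z , color z y
      h : Carrier (S ⊗ S) → ℕ
      h (b , c) = ∇ (b ⁻¹) a c
      xy∈a⇔a≡d : color x y ≡ a ⇔ a ≡ d
      xy∈a⇔a≡d = mk⇔ (λ xy∈a → trans (sym xy∈a) xy∈d) (λ a≡d → trans xy∈d (sym a≡d))
      count : ∀ b c → ∇ b c d ≡ card X (λ z → FinSet._≟_ (S ⊗ S) (φ z) (b , c))
      count b c = trans (∇-paths b c xy∈d)
        (card-cong X _ _ λ z → mk⇔ (λ (p , q) → cong₂ _,_ p q) λ { refl → refl , refl })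

    comult-≈ : comult (frobenius C) ≈ℕ λ a p → ∇ (proj₁ p ⁻¹) a (proj₂ p)
    comult-≈ = entrywise λ a p →
      ratio-≐ (∇ (proj₁ p ⁻¹) a (proj₂ p)) ‖ proj₁ p ⁻¹ ‖ (thin (proj₁ p ⁻¹))

    thin⇒special : Special (frobenius C)
    thin⇒special = fromℕ size , from equal-entries ∑-∇-∇
      where
      size : ℕ
      size = ∑ℕ X λ _ → 1

      equal-entries : (mult (frobenius C) ∘ᴹ comult (frobenius C) ≈ fromℕ size • id) ⇔
        (∀ a d → ∑ℕ (S ⊗ S) (λ (b , c) → ∇ (b ⁻¹) a c * ∇ b c d) ≡ size * χ (a ≟ d))
      equal-entries = ≈⇔≡ (∘ᴹ-≈ (mult (frobenius C)) (comult (frobenius C)) mult-≈ comult-≈) (•-≈ size id-≈)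

  -- All terms of the sum are non-negative and the one at `(b , c)` is positive.
  mult∘comult-pos : ∀ a b c d → 0 ℕ.< ∇ (b ⁻¹) a c → 0 ℕ.< ∇ b c d →
    ∃[ q ] (entry (mult (frobenius C) ∘ᴹ comult (frobenius C)) a d ≐ q × 0ℚ ℚ.< q)
  mult∘comult-pos a b c d pos₁ pos₂ =
    let q , ∑≐q , bound = ∑-upper-bound (S ⊗ S) {f} {g} (λ _ _ → refl) g-nonNeg
    in q , ∑≐q , ℚ.<-≤-trans g-pos (bound (b , c))
    where
    f : Carrier (S ⊗ S) → ℝ≥0
    f p = entry (comult (frobenius C)) a p ⊙ entry (mult (frobenius C)) p d

    g : Carrier (S ⊗ S) → ℚ
    g (b , c) = (ℤ.+ ∇ (b ⁻¹) a c ℚ./ ‖ b ⁻¹ ‖) ℚ.* ι (∇ b c d)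

    g-nonNeg : ∀ p → 0ℚ ℚ.≤ g p
    g-nonNeg (b , c) = ratio-*-ι-nonNeg (∇ (b ⁻¹) a c) ‖ b ⁻¹ ‖ (∇ b c d)

    g-pos : 0ℚ ℚ.< g (b , c)
    g-pos = ratio-*-ι-pos (∇ (b ⁻¹) a c) ‖ b ⁻¹ ‖ (∇ b c d) pos₁ pos₂

  special⇒thin : Special (frobenius C) → Thin C
  special⇒thin (t , special) = functional-thin returns
    where
    -- The sequence of `t` need not be constant, but its product with 0 is, so `≃⇒≡` still applies.
    off-diagonal : ∀ {a d} → a ≢ d → entry (t • id {S}) a d ≐ 0ℚ
    off-diagonal {a} {d} a≢d n = begin
      seq (val t) n ℚ.* seq (val ⟦ a ≟ d ⟧) n  ≡⟨ cong (seq (val t) n ℚ.*_) (constant (⟦⟧-≐ (a ≟ d)) n) ⟩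
      seq (val t) n ℚ.* ι (χ (a ≟ d))          ≡⟨ cong (λ m → seq (val t) n ℚ.* ι m) (χ-false (a ≟ d) a≢d) ⟩
      seq (val t) n ℚ.* 0ℚ                     ≡⟨ ℚ.*-zeroʳ (seq (val t) n) ⟩
      0ℚ                                       ∎

    diagonal-support : ∀ a b c d → 0 ℕ.< ∇ (b ⁻¹) a c → 0 ℕ.< ∇ b c d → a ≡ d
    diagonal-support a b c d pos₁ pos₂ = decidable-stable (a ≟ d) λ a≢d →
      let q , entry≐q , 0<q = mult∘comult-pos a b c d pos₁ pos₂ in
      ℚ.<⇒≢ 0<q (sym (≃⇒≡
        {entry (mult (frobenius C) ∘ᴹ comult (frobenius C)) a d} {entry (t • id {S}) a d}
        entry≐q (off-diagonal a≢d) (special a d)))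

    returns : ∀ {x y z} → color x y ≡ color x z → y ≡ z
    -- The midpoint `y` of a path from `x` to `z` gives the first factor: its first step has color
    -- `color z x ⁻¹` because `color x y ≡ color x z`. The midpoint `x` of a path from `z` back to
    -- `z` gives the second.
    returns {x} {y} {z} xy≡xz = diagonal refl
      (diagonal-support (color y z) (color z x) (color x z) (color z z)
        (∇-pos {color z x ⁻¹} {color y z} {color x z} y refl (trans xy≡xz (color-converse refl)) refl)
        (∇-pos {color z x} {color x z} {color z z} x refl refl refl))

  -- Symmetry as equality of the valencies of converse colors.

  -- A pair in a unit color is a loop, so a path over it goes out along `a` and retraces the same
  -- step.
  unit-∇-pos : ∀ {a b c} → IsUnit c → 0 ℕ.< ∇ a b c → b ≡ a ⁻¹ × c ≡ source a
  unit-∇-pos {c = c} unit pos with x , y , xy∈c ← nonempty c with refl ← unit xy∈c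
    with z , xz∈a , zx∈b ← Card-Lemmas.card-witness X _ pos =
    trans (sym zx∈b) (color-converse xz∈a) , trans (sym xy∈c) (sym (color-source xz∈a))

  -- The entry at `(a , b)` of the counit after the multiplication.
  counit-mult : Carrier S → Carrier S → ℕ
  counit-mult a b = ∑ℕ S λ c → ∇ a b c * χ (isUnit? c)

  counit-mult-vanishes : ∀ {a b c} → ¬ (b ≡ a ⁻¹ × c ≡ source a) → ∇ a b c * χ (isUnit? c) ≡ 0
  counit-mult-vanishes {a} {b} {c} ¬p with isUnit? c
  ... | no  _    = ℕ.*-zeroʳ (∇ a b c)
  ... | yes unit with ∇ a b c in eq
  ...   | zero  = refl
  ...   | suc _ = contradiction (unit-∇-pos unit (subst (0 ℕ.<_) (sym eq) ℕ.z<s)) ¬p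

  counit-mult-⁻¹ : ∀ a → counit-mult a (a ⁻¹) ≡ ‖ a ‖
  counit-mult-⁻¹ a = begin
    counit-mult a (a ⁻¹)
      -- The surviving coefficient `∇ a (a ⁻¹) (source a)` is `‖ a ‖` by definition.
      ≡⟨ ∑ℕ-single S _ (source a) (λ c c≢s → counit-mult-vanishes {a} {a ⁻¹} {c} (c≢s ∘ proj₂)) ⟩
    ‖ a ‖ * χ (isUnit? (source a))
      ≡⟨ cong (‖ a ‖ *_) (χ-true (isUnit? (source a)) (source-unit a)) ⟩
    ‖ a ‖ * 1
      ≡⟨ ℕ.*-identityʳ ‖ a ‖ ⟩
    ‖ a ‖
      ∎

  counit-mult-other : ∀ {a b} → b ≢ a ⁻¹ → counit-mult a b ≡ 0
  counit-mult-other {a} {b} b≢a⁻¹ = ∑ℕ-zero S λ c → counit-mult-vanishes {a} {b} {c} (b≢a⁻¹ ∘ proj₁)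

  -- Row `p` of `σ` has its single 1 at `swap p`, so precomposing with `σ` exchanges the two
  -- arguments.
  symmetric⇔counit-mult-comm : Symmetric (frobenius C) ⇔ (∀ a b → counit-mult b a ≡ counit-mult a b)
  symmetric⇔counit-mult-comm = mk⇔
    (λ symmetric a b → trans (sym (after-σ a b)) (to equal-entries symmetric (a , b) tt))
    (λ comm → from equal-entries λ { (a , b) tt → trans (after-σ a b) (comm a b) })
    where
    σ-mult : Carrier (S ⊗ S) → Carrier S → ℕ
    σ-mult p c = ∑ℕ (S ⊗ S) λ q → χ (FinSet._≟_ (S ⊗ S) (swap p) q) * ∇ (proj₁ q) (proj₂ q) c

    equal-entries : Symmetric (frobenius C) ⇔
      (∀ p _ → ∑ℕ S (λ c → σ-mult p c * χ (isUnit? c)) ≡ counit-mult (proj₁ p) (proj₂ p))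
    equal-entries = ≈⇔≡
      (∘ᴹ-≈ (counit (frobenius C)) (mult (frobenius C) ∘ᴹ σ S S) counit-≈
        (∘ᴹ-≈ (mult (frobenius C)) (σ S S) mult-≈ (σ-≈ {S} {S})))
      (∘ᴹ-≈ (counit (frobenius C)) (mult (frobenius C)) counit-≈ mult-≈)

    after-σ : ∀ a b → ∑ℕ S (λ c → σ-mult (a , b) c * χ (isUnit? c)) ≡ counit-mult b a
    after-σ a b = ∑ℕ-cong S λ c → cong (_* χ (isUnit? c))
      (∑ℕ-χ-* (S ⊗ S) (λ q → ∇ (proj₁ q) (proj₂ q) c) (b , a))

  -- At `b ≡ a ⁻¹` the two sides are the valencies of `a ⁻¹` and `a`. At every other pair both
  -- vanish, since taking converses is an involution.
  counit-mult-comm⇔valency-⁻¹ :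
    (∀ a b → counit-mult b a ≡ counit-mult a b) ⇔ (∀ a → ‖ a ⁻¹ ‖ ≡ ‖ a ‖)
  counit-mult-comm⇔valency-⁻¹ = mk⇔
    (λ comm a → begin
      ‖ a ⁻¹ ‖                        ≡⟨ counit-mult-⁻¹ (a ⁻¹) ⟨
      counit-mult (a ⁻¹) ((a ⁻¹) ⁻¹)  ≡⟨ cong (counit-mult (a ⁻¹)) (⁻¹-involutive a) ⟩
      counit-mult (a ⁻¹) a            ≡⟨ comm a (a ⁻¹) ⟩
      counit-mult a (a ⁻¹)            ≡⟨ counit-mult-⁻¹ a ⟩
      ‖ a ‖                           ∎)
    backward
    where
    backward : (∀ a → ‖ a ⁻¹ ‖ ≡ ‖ a ‖) → ∀ a b → counit-mult b a ≡ counit-mult a b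
    backward valency a b with b ≟ a ⁻¹
    ... | yes refl = begin
      counit-mult (a ⁻¹) a            ≡⟨ cong (counit-mult (a ⁻¹)) (⁻¹-involutive a) ⟨
      counit-mult (a ⁻¹) ((a ⁻¹) ⁻¹)  ≡⟨ counit-mult-⁻¹ (a ⁻¹) ⟩
      ‖ a ⁻¹ ‖                        ≡⟨ valency a ⟩
      ‖ a ‖                           ≡⟨ counit-mult-⁻¹ a ⟨
      counit-mult a (a ⁻¹)            ∎
    ... | no b≢a⁻¹ = trans
      (counit-mult-other λ { refl → b≢a⁻¹ (sym (⁻¹-involutive b)) })
      (sym (counit-mult-other b≢a⁻¹))

  -- Double counting of the pairs in a color.

  loops : Carrier S → ℕ
  loops p = card X λ x → color x x ≟ p

  -- A unit block lies on the diagonal, so the map `x ↦ (x , x)` has exactly one preimage over each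
  -- of its pairs.
  loops≡blockSize : ∀ {p} → IsUnit p → loops p ≡ blockSize p
  loops≡blockSize {p} unit = begin
    loops p
      ≡⟨ card-∑ℕ X _ ⟩
    ∑ℕ X (h ∘ φ)
      ≡⟨ ∑ℕ-fibres X (X ⊗ X) φ h ⟩
    ∑ℕ (X ⊗ X) (λ w → card X (λ x → FinSet._≟_ (X ⊗ X) (φ x) w) * h w)
      ≡⟨ ∑ℕ-cong (X ⊗ X) (λ (x , y) → fibre x y (color x y ≟ p)) ⟩
    ∑ℕ (X ⊗ X) h
      ≡⟨ card-∑ℕ (X ⊗ X) _ ⟨
    blockSize p
      ∎
    where
    φ : Carrier X → Carrier (X ⊗ X)
    φ x = x , x
    h : Carrier (X ⊗ X) → ℕ
    h (x , y) = χ (color x y ≟ p)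
    fibre : ∀ x y (xy∈p? : Dec (color x y ≡ p)) →
      card X (λ z → FinSet._≟_ (X ⊗ X) (φ z) (x , y)) * χ xy∈p? ≡ χ xy∈p?
    fibre x y (no  _)    = ℕ.*-zeroʳ (card X λ z → FinSet._≟_ (X ⊗ X) (φ z) (x , y))
    fibre x y (yes xy∈p) with refl ← unit xy∈p =
      trans (ℕ.*-identityʳ _) (card-unique X _ x refl λ z → cong proj₁)

  loops-pos : ∀ {p} → IsUnit p → 0 ℕ.< loops p
  loops-pos {p} unit with x , y , xy∈p ← nonempty p with refl ← unit xy∈p =
    Card-Lemmas.card-pos X _ x xy∈p

  -- A pair in `a` can only start at a point whose loop has color `source a`, and each such point
  -- starts `‖ a ‖` of them.
  ∑-outDegree : ∀ a → ∑ℕ X (outDegree a) ≡ loops (source a) * ‖ a ‖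
  ∑-outDegree a = begin
    ∑ℕ X (outDegree a)
      ≡⟨ ∑ℕ-cong X (λ x → at x (color x x ≟ source a)) ⟩
    ∑ℕ X (λ x → χ (color x x ≟ source a) * ‖ a ‖)
      ≡⟨ ∑ℕ-*ʳ X ‖ a ‖ (λ x → χ (color x x ≟ source a)) ⟨
    ∑ℕ X (λ x → χ (color x x ≟ source a)) * ‖ a ‖
      ≡⟨ cong (_* ‖ a ‖) (card-∑ℕ X _) ⟨
    loops (source a) * ‖ a ‖
      ∎
    where
    at : ∀ x (xx∈s? : Dec (color x x ≡ source a)) → outDegree a x ≡ χ xx∈s? * ‖ a ‖
    at x (yes xx∈s) = trans (outDegree-valency xx∈s) (sym (ℕ.*-identityˡ ‖ a ‖))
    at x (no  xx∉s) = card-none X _ λ y xy∈a → xx∉s (sym (color-source xy∈a))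

  -- The pairs in `a` are counted by first point on one side and by second point on the other.
  ∑-outDegree-⁻¹ : ∀ a → ∑ℕ X (outDegree a) ≡ ∑ℕ X (outDegree (a ⁻¹))
  ∑-outDegree-⁻¹ a = begin
    ∑ℕ X (outDegree a)
      ≡⟨ ∑ℕ-cong X (λ x → card-∑ℕ X λ y → color x y ≟ a) ⟩
    ∑ℕ X (λ x → ∑ℕ X λ y → χ (color x y ≟ a))
      ≡⟨ ∑ℕ-comm X X (λ x y → χ (color x y ≟ a)) ⟩
    ∑ℕ X (λ y → ∑ℕ X λ x → χ (color x y ≟ a))
      ≡⟨ ∑ℕ-cong X (λ y → ∑ℕ-cong X λ x →
           χ-cong (mk⇔ color-converse color-converse⁻) (color x y ≟ a) (color y x ≟ a ⁻¹)) ⟩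
    ∑ℕ X (λ y → ∑ℕ X λ x → χ (color y x ≟ a ⁻¹))
      ≡⟨ ∑ℕ-cong X (λ y → card-∑ℕ X λ x → color y x ≟ a ⁻¹) ⟨
    ∑ℕ X (outDegree (a ⁻¹))
      ∎

  loops-valency : ∀ a → loops (source a) * ‖ a ‖ ≡ loops (source (a ⁻¹)) * ‖ a ⁻¹ ‖
  loops-valency a = trans (sym (∑-outDegree a)) (trans (∑-outDegree-⁻¹ a) (∑-outDegree (a ⁻¹)))

  valency-⁻¹⇔½-homogeneous : (∀ a → ‖ a ⁻¹ ‖ ≡ ‖ a ‖) ⇔ ½-Homogeneous C
  valency-⁻¹⇔½-homogeneous = mk⇔ forward backward
    where
    forward : (∀ a → ‖ a ⁻¹ ‖ ≡ ‖ a ‖) → ½-Homogeneous C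
    forward valency p q unit-p unit-q
      with x , x′ , xx∈p ← nonempty p | y , y′ , yy∈q ← nonempty q
      with refl ← unit-p xx∈p | refl ← unit-q yy∈q = begin
        blockSize p          ≡⟨ loops≡blockSize unit-p ⟨
        loops p              ≡⟨ cong loops (trans (color-source refl) xx∈p) ⟨
        loops (source a)     ≡⟨ ℕ.*-cancelʳ-≡ _ _ ‖ a ‖
                                  (trans (loops-valency a) (cong (loops (source (a ⁻¹)) *_) (valency a))) ⟩
        loops (source (a ⁻¹)) ≡⟨ cong loops (trans (color-source (color-converse refl)) yy∈q) ⟩
        loops q              ≡⟨ loops≡blockSize unit-q ⟩
        blockSize q          ∎
      where
      -- Here `x` carries a loop in `p` and `y` a loop in `q`, so `p` and `q` are the sources of
      -- this color and of its converse.
      a = color x y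

    backward : ½-Homogeneous C → ∀ a → ‖ a ⁻¹ ‖ ≡ ‖ a ‖
    -- The common number of loops cancels because a unit block is nonempty.
    backward homogeneous a = sym (ℕ.*-cancelˡ-≡ _ _ (loops (source a))
      {{ℕ.>-nonZero (loops-pos (source-unit a))}}
      (trans (loops-valency a) (cong (_* ‖ a ⁻¹ ‖) same-loops)))
      where
      same-loops : loops (source (a ⁻¹)) ≡ loops (source a)
      same-loops = begin
        loops (source (a ⁻¹))      ≡⟨ loops≡blockSize (source-unit (a ⁻¹)) ⟩
        blockSize (source (a ⁻¹))  ≡⟨ homogeneous _ _ (source-unit (a ⁻¹)) (source-unit a) ⟩
        blockSize (source a)       ≡⟨ loops≡blockSize (source-unit a) ⟨
        loops (source a)           ∎

  -- Extra structures and association schemes.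

  -- The only entry of the composite is a sum of squares of indicators, and these squares are the
  -- indicators themselves.
  extra⇔one-unit : Extra (frobenius C) ⇔ (card S isUnit? ≡ 1)
  extra⇔one-unit = mk⇔
    (λ extra → trans card≡∑ (to equal-entries extra tt tt))
    (λ card≡1 → from equal-entries λ _ _ → trans (sym card≡∑) card≡1)
    where
    equal-entries : Extra (frobenius C) ⇔
      (∀ x y → ∑ℕ S (λ a → χ (isUnit? a) * χ (isUnit? a)) ≡ χ (FinSet._≟_ I x y))
    equal-entries = ≈⇔≡ (∘ᴹ-≈ (counit (frobenius C)) (unit (frobenius C)) counit-≈ unit-≈) id-≈

    χ-idem : ∀ {P : Set} (P? : Dec P) → χ P? ≡ χ P? * χ P?
    χ-idem (yes _) = refl
    χ-idem (no  _) = refl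

    card≡∑ : card S isUnit? ≡ ∑ℕ S (λ a → χ (isUnit? a) * χ (isUnit? a))
    card≡∑ = trans (card-∑ℕ S isUnit?) (∑ℕ-cong S λ a → χ-idem (isUnit? a))

  -- Every loop has a unit color, so a sole unit color contains the whole diagonal. Conversely,
  -- every unit color contains some loop, so it equals the color that is the diagonal.
  one-unit⇔scheme : (card S isUnit? ≡ 1) ⇔ IsAssociationScheme C
  one-unit⇔scheme = mk⇔ forward backward
    where
    forward : card S isUnit? ≡ 1 → IsAssociationScheme C
    forward card≡1 with p , unit ← Card-Lemmas.card-witness S isUnit? (ℕ.≤-reflexive (sym card≡1)) =
      p , λ x y → mk⇔ unit λ { refl → card≡1⇒unique S isUnit? card≡1 (diagonal refl) unit }

    backward : IsAssociationScheme C → card S isUnit? ≡ 1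
    backward (p , p⇔id) = card-unique S isUnit? p (λ {x} {y} → to (p⇔id x y)) unique
      where
      unique : ∀ q → IsUnit q → q ≡ p
      unique q unit with x , y , xy∈q ← nonempty q with refl ← unit xy∈q =
        trans (sym xy∈q) (from (p⇔id x x) refl)

theorem3p3 : (C : CoherentConfiguration) →
    (Special (frobenius C) ⇔ Thin C)
    × (Symmetric (frobenius C) ⇔ ½-Homogeneous C)
    × (Extra (frobenius C) ⇔ IsAssociationScheme C)
theorem3p3 C =
    mk⇔ (special⇒thin C) (thin⇒special C)
  , valency-⁻¹⇔½-homogeneous C ⇔-∘ (counit-mult-comm⇔valency-⁻¹ C ⇔-∘ symmetric⇔counit-mult-comm C)
  , one-unit⇔scheme C ⇔-∘ extra⇔one-unit C
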